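{- Let $k\ge 3$ and $r\ge 2$ be integers. Let $K_r$ be the $r\times r$ matrix whose $(p,q)$ entry is $\binom{k-2+q-p}{k-3}$ if $q\ge p$, $1$ if $q=p-1$, and $0$ if $q<p-1$. Let $x=(x_{r-1},x_{r-2},\ldots,x_{0})^{\top}$ be an eigenvector of $K_r$ associated to an eigenvalue $\lambda$. Then for all $i=1,\dots,r-1$, $$x_{i} = (-1)^{i}k_{i}(\lambda)x_{0},$$ where $k_{i}(\lambda)$ is the characteristic polynomial of the $i\times i$ matrix $K_{i}$.
   Context: The characteristic polynomial of an $i\times i$ matrix $K_i$ is $\det(K_i-\lambda I)$. The matrix $K_i$ is defined by the same entry formula with size $i$. The entries of $x$ are indexed in decreasing order, so $x_0$ is the last entry. -}

module Defs where

open import Algebra.Apartness.Bundles using (HeytingField; HeytingCommutativeRing)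
open import Algebra.Bundles using (CommutativeRing; Semiring)
import Algebra.Definitions.RawSemiring as RawSemiringDefinitions
open import Data.Bool.Base using (if_then_else_)
open import Data.Fin.Base using (Fin; zero; suc; toℕ)
import Data.Fin.Properties as Fin
open import Data.Nat.Base as ℕ using (ℕ; zero; suc; _∸_; _≤ᵇ_; _≡ᵇ_)
open import Data.Nat.Combinatorics using (_C_)
open import Data.Vec.Functional using (Vector; removeAt)
open import Level using (_⊔_)
open import Relation.Nullary using (¬_; does)

Matrix : ∀ {a} → Set a → ℕ → ℕ → Set a
Matrix A m n = Fin m → Fin n → A

-- For k ≥ 3 no subtraction is truncated in the branch that is selected.
-- Only q ∸ p matters, so p and q may be counted from 0.
entry : ℕ → ℕ → ℕ → ℕ
entry k p q =
  if p ≤ᵇ q then (k ∸ 2 ℕ.+ q ∸ p) C (k ∸ 3)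
  else if suc q ≡ᵇ p then 1
  else 0

module OverField {c ℓ₁ ℓ₂} (F : HeytingField c ℓ₁ ℓ₂) where

  open HeytingField F
    using (Carrier; _≈_; _*_; _-_; -_; 0#; 1#; heytingCommutativeRing)
  open CommutativeRing
    (HeytingCommutativeRing.commutativeRing heytingCommutativeRing)
    using (semiring)
  open RawSemiringDefinitions (Semiring.rawSemiring semiring) public using (_×_; _^_; sum)

  -- Cofactor expansion along the first row.
  det : ∀ {n} → Matrix Carrier n n → Carrier
  det {zero}  M = 1#
  det {suc n} M = sum λ q →
    (- 1#) ^ toℕ q * M zero q * det (λ p → removeAt (M (suc p)) q)

  identity : ∀ {n} → Matrix Carrier n n
  identity p q = if does (p Fin.≟ q) then 1# else 0#

  -- As a function of the point t at which it is evaluated: det (M - t I).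
  charPoly : ∀ {n} → Matrix Carrier n n → Carrier → Carrier
  charPoly M t = det λ p q → M p q - t * identity p q

  _*ᵥ_ : ∀ {m n} → Matrix Carrier m n → Vector Carrier n → Vector Carrier m
  (M *ᵥ v) p = sum λ q → M p q * v q

  record IsEigenvector {n} (M : Matrix Carrier n n) (ev : Carrier)
                       (v : Vector Carrier n) : Set (c ⊔ ℓ₁) where
    field
      nonzero  : ¬ (∀ p → v p ≈ 0#)
      equation : ∀ p → (M *ᵥ v) p ≈ ev * v p

  K : ℕ → (n : ℕ) → Matrix Carrier n n
  K k n p q = entry k (toℕ p) (toℕ q) × 1#

{-# OPTIONS --safe #-}

-- The matrices K k n - ev I are Toeplitz and upper Hessenberg with ones on the
-- subdiagonal.  Deleting row 0 and column q leaves a matrix whose first q columns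
-- are unitriangular over zeros, so that minor is the determinant of size n - q,
-- and first-row expansion is a recurrence for the characteristic polynomials.
-- Up to the sign (-1)^n it is the recurrence by which the rows of the eigenvector
-- equation other than the first determine each coordinate from the later ones.
module Submission where

open import Defs
open import Algebra.Apartness.Bundles using (HeytingField; HeytingCommutativeRing)
open import Algebra.Bundles using (CommutativeRing)
import Algebra.Properties.CommutativeSemigroup as CommutativeSemigroupProperties
import Algebra.Properties.Ring as RingProperties
import Algebra.Properties.Semiring.Sum as SumProperties
import Algebra.Solver.CommutativeMonoid as CommutativeMonoidSolver
open import Data.Fin.Base using (Fin; zero; suc; toℕ; fromℕ; fromℕ<; opposite; punchIn)
open import Data.Fin.Properties using (opposite-involutive; opposite-prop; toℕ-fromℕ<)
open import Data.Nat.Base using (ℕ; zero; suc; _∸_; _≤_; _<_; s≤s; z≤n)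
open import Data.Nat.Properties as ℕ using (<⇒≤)
open import Data.Vec.Functional using (Vector; removeAt; reverse)
open import Function.Base using (_∘_)
open import Level using (_⊔_)
open import Relation.Binary.PropositionalEquality as ≡ using (_≡_)
import Relation.Binary.Reasoning.Setoid as SetoidReasoning

entry-suc : ∀ k p q → entry k (suc p) (suc q) ≡ entry k p q
-- The split on `p` is forced by `_≤ᵇ_`, which on a successor reduces to `_<ᵇ_` and so does not peel
-- both arguments at once.
entry-suc k zero    q rewrite ℕ.+-suc (k ∸ 2) q = ≡.refl
entry-suc k (suc p) q rewrite ℕ.+-suc (k ∸ 2) q = ≡.refl

module HessenbergToeplitz {c ℓ₁ ℓ₂} (F : HeytingField c ℓ₁ ℓ₂) where

  open CommutativeRing
    (HeytingCommutativeRing.commutativeRing (HeytingField.heytingCommutativeRing F))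
    hiding (zero)
  open OverField F
  open RingProperties ring
    using (-1*x≈-x; -‿involutive; -‿distribˡ-*; +-inverseˡ-unique; -0#≈0#)
  open SumProperties semiring
    using (sum-cong-≋; sum-replicate-zero; ∑-distrib-+; *-distribˡ-sum; *-distribʳ-sum)
  open CommutativeSemigroupProperties *-commutativeSemigroup using (interchange)
  open CommutativeMonoidSolver *-commutativeMonoid using (solve; _⊕_; _⊜_)
  open SetoidReasoning setoid

  sum-zero : ∀ {n} (f : Vector Carrier n) → (∀ q → f q ≈ 0#) → sum f ≈ 0#
  sum-zero {n} f f≈0 = trans (sum-cong-≋ f≈0) (sum-replicate-zero n)

  -- Includes the entry of row 0, unlike the usual cofactor, so that `det M` unfolds to
  -- `sum (cofactor M)`.
  cofactor : ∀ {n} → Matrix Carrier (suc n) (suc n) → Vector Carrier (suc n)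
  cofactor M q = (- 1#) ^ toℕ q * M zero q * det (λ p → removeAt (M (suc p)) q)

  det-cong : ∀ {n} {M N : Matrix Carrier n n} → (∀ p q → M p q ≈ N p q) → det M ≈ det N
  det-cong {zero}  M≈N = refl
  det-cong {suc n} {M} {N} M≈N = sum-cong-≋ {x = cofactor M} {y = cofactor N} λ q →
    *-cong (*-congˡ (M≈N zero q)) (det-cong λ p j → M≈N (suc p) (punchIn q j))

  -- The term at column 0 has a zero factor. Every other minor keeps column 0, still zero, so
  -- induction on the size applies.
  det-zeroColumn : ∀ {n} (M : Matrix Carrier (suc n) (suc n)) →
                   (∀ p → M p zero ≈ 0#) → det M ≈ 0#
  det-zeroColumn {n} M M₀≈0 = sum-zero (cofactor M) (cofactor-zero M M₀≈0)
    where
    cofactor-zero : ∀ {n} (M : Matrix Carrier (suc n) (suc n)) →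
                    (∀ p → M p zero ≈ 0#) → ∀ q → cofactor M q ≈ 0#
    cofactor-zero         M M₀≈0 zero    =
      trans (*-congʳ (trans (*-congˡ (M₀≈0 zero)) (zeroʳ _))) (zeroˡ _)
    cofactor-zero {suc n} M M₀≈0 (suc q) =
      trans (*-congˡ (det-zeroColumn (λ p → removeAt (M (suc p)) (suc q)) (M₀≈0 ∘ suc))) (zeroʳ _)

  -- Column expansion in the one case required, obtained from the row expansion: every minor other
  -- than the first retains a zero column.
  det-firstColumn : ∀ {n} (M : Matrix Carrier (suc n) (suc n)) →
                    (∀ p → M (suc p) zero ≈ 0#) →
                    det M ≈ M zero zero * det (λ p q → M (suc p) (suc q))
  det-firstColumn {zero}  M M₀≈0 = trans (+-identityʳ _) (*-congʳ (*-identityˡ _))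
  det-firstColumn {suc n} M M₀≈0 = trans
    (+-cong (*-congʳ (*-identityˡ _))
            (sum-zero (cofactor M ∘ suc) λ q → trans
              (*-congˡ (det-zeroColumn (λ p → removeAt (M (suc p)) (suc q)) M₀≈0)) (zeroʳ _)))
    (+-identityʳ _)

  -- `n + q` and `n - q` have the same parity; the bound on `q` keeps `∸` from truncating.
  sign-∸ : ∀ n (q : Fin (suc n)) →
           (- 1#) ^ n * (- 1#) ^ toℕ q ≈ (- 1#) ^ (n ∸ toℕ q)
  sign-∸ n       zero    = *-identityʳ _
  sign-∸ (suc n) (suc q) = begin
    (- 1# * (- 1#) ^ n) * (- 1# * (- 1#) ^ toℕ q)  ≈⟨ interchange _ _ _ _ ⟩
    (- 1# * - 1#) * ((- 1#) ^ n * (- 1#) ^ toℕ q)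
      ≈⟨ *-cong (trans (-1*x≈-x (- 1#)) (-‿involutive 1#)) (sign-∸ n q) ⟩
    1# * (- 1#) ^ (n ∸ toℕ q)                      ≈⟨ *-identityˡ _ ⟩
    (- 1#) ^ (n ∸ toℕ q)                           ∎

  -- A family over all sizes, so that being Toeplitz becomes nesting: deleting row 0 and column 0
  -- gives the previous member.
  record IsUnitHessenbergToeplitz (B : ∀ n → Matrix Carrier n n) : Set (c ⊔ ℓ₁) where
    field
      toeplitz    : ∀ n (p q : Fin n) → B (suc n) (suc p) (suc q) ≈ B n p q
      subdiagonal : ∀ n → B (suc (suc n)) (suc zero) zero ≈ 1#
      hessenberg  : ∀ n p → B (suc (suc n)) (suc (suc p)) zero ≈ 0#

  module _ {B : ∀ n → Matrix Carrier n n} (isUHT : IsUnitHessenbergToeplitz B) where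
    open IsUnitHessenbergToeplitz isUHT

    -- For positive `q` the minor keeps column 0, which below row 0 reads 1, 0, ..., 0. Stripping it
    -- leaves the same minor with `n` and `q` both lowered by one.
    det-minor : ∀ n (q : Fin (suc n)) →
                det (λ p → removeAt (B (suc n) (suc p)) q) ≈ det (B (n ∸ toℕ q))
    det-minor n       zero    = det-cong (toeplitz n)
    det-minor (suc n) (suc q) = begin
      det (λ p → removeAt (B (suc (suc n)) (suc p)) (suc q))
        ≈⟨ det-firstColumn (λ p → removeAt (B (suc (suc n)) (suc p)) (suc q)) (hessenberg n) ⟩
      B (suc (suc n)) (suc zero) zero *
        det (λ p → removeAt (B (suc (suc n)) (suc (suc p)) ∘ suc) q)
        ≈⟨ *-cong (subdiagonal n) (det-cong λ p j → toeplitz (suc n) (suc p) (punchIn q j)) ⟩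
      1# * det (λ p → removeAt (B (suc n) (suc p)) q)
        ≈⟨ *-identityˡ _ ⟩
      det (λ p → removeAt (B (suc n) (suc p)) q)
        ≈⟨ det-minor n q ⟩
      det (B (n ∸ toℕ q))  ∎

    -- Back substitution: row `p + 1` has its leading 1 in column `p`, so the rows below row 0
    -- determine every coordinate from the last.
    kernel-coordinate : ∀ n (v : Vector Carrier (suc n)) →
                        (∀ p → sum (λ q → B (suc n) (suc p) q * v q) ≈ 0#) →
                        ∀ p → v p ≈ (- 1#) ^ (n ∸ toℕ p) * det (B (n ∸ toℕ p)) * v (fromℕ n)
    kernel-coordinate zero    v rows zero = sym (trans (*-congʳ (*-identityˡ _)) (*-identityˡ _))
    kernel-coordinate (suc n) v rows = coordinate
      where
      tail : ∀ p → v (suc p) ≈ (- 1#) ^ (n ∸ toℕ p) * det (B (n ∸ toℕ p)) * v (suc (fromℕ n))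
      -- Rows from 2 on vanish in column 0, so they act on the tail of `v` as the corresponding rows
      -- one size down.
      tail = kernel-coordinate n (v ∘ suc) λ p → begin
        sum (λ q → B (suc n) (suc p) q * v (suc q))
          ≈⟨ sum-cong-≋ {x = λ q → B (suc (suc n)) (suc (suc p)) (suc q) * v (suc q)}
                        (λ q → *-congʳ (toeplitz (suc n) (suc p) q)) ⟨
        sum (λ q → B (suc (suc n)) (suc (suc p)) (suc q) * v (suc q))
          ≈⟨ trans (+-congʳ (trans (*-congʳ (hessenberg n p)) (zeroˡ _))) (+-identityˡ _) ⟨
        sum (λ q → B (suc (suc n)) (suc (suc p)) q * v q)
          ≈⟨ rows (suc p) ⟩
        0#  ∎

      last = v (suc (fromℕ n))

      term : ∀ q → B (suc n) zero q * v (suc q) ≈ (- 1#) ^ n * cofactor (B (suc n)) q * last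
      term q = begin
        B (suc n) zero q * v (suc q)
          ≈⟨ *-congˡ (tail q) ⟩
        B (suc n) zero q * ((- 1#) ^ (n ∸ toℕ q) * det (B (n ∸ toℕ q)) * last)
          -- Splitting the sign turns the summand into a term of the first-row expansion of
          -- `B (suc n)`, up to a factor independent of `q`.
          ≈⟨ *-congˡ (*-congʳ (*-cong (sign-∸ n q) (det-minor n q))) ⟨
        B (suc n) zero q * ((- 1#) ^ n * (- 1#) ^ toℕ q * det (λ p → removeAt (B (suc n) (suc p)) q) * last)
          ≈⟨ solve 5 (λ b s t d l → b ⊕ (((s ⊕ t) ⊕ d) ⊕ l) ⊜ (s ⊕ ((t ⊕ b) ⊕ d)) ⊕ l) refl _ _ _ _ _ ⟩
        (- 1#) ^ n * cofactor (B (suc n)) q * last  ∎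

      rest : sum (λ q → B (suc n) zero q * v (suc q)) ≈ (- 1#) ^ n * det (B (suc n)) * last
      rest = begin
        sum (λ q → B (suc n) zero q * v (suc q))
          ≈⟨ sum-cong-≋ term ⟩
        sum (λ q → (- 1#) ^ n * cofactor (B (suc n)) q * last)
          ≈⟨ *-distribʳ-sum last (λ q → (- 1#) ^ n * cofactor (B (suc n)) q) ⟨
        sum (λ q → (- 1#) ^ n * cofactor (B (suc n)) q) * last
          ≈⟨ *-congʳ (*-distribˡ-sum ((- 1#) ^ n) (cofactor (B (suc n)))) ⟨
        (- 1#) ^ n * det (B (suc n)) * last  ∎

      -- Past its leading 1, row 1 is row 0 of `B (suc n)`. Solving for `v zero` contributes the one
      -- further sign.
      row₁ : v zero + sum (λ q → B (suc n) zero q * v (suc q)) ≈ 0#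
      row₁ = trans
        (sym (+-cong (trans (*-congʳ (subdiagonal n)) (*-identityˡ _))
                     (sum-cong-≋ {x = λ q → B (suc (suc n)) (suc zero) (suc q) * v (suc q)}
                                 λ q → *-congʳ (toeplitz (suc n) zero q))))
        (rows zero)

      coordinate : ∀ p → v p ≈ (- 1#) ^ (suc n ∸ toℕ p) * det (B (suc n ∸ toℕ p)) * last
      coordinate (suc p) = tail p
      coordinate zero    = begin
        v zero                                           ≈⟨ +-inverseˡ-unique _ _ row₁ ⟩
        - sum (λ q → B (suc n) zero q * v (suc q))       ≈⟨ -‿cong (trans rest (*-assoc _ _ _)) ⟩
        - ((- 1#) ^ n * (det (B (suc n)) * last))        ≈⟨ -1*x≈-x _ ⟨
        - 1# * ((- 1#) ^ n * (det (B (suc n)) * last))   ≈⟨ *-assoc _ _ _ ⟨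
        (- 1#) ^ suc n * (det (B (suc n)) * last)        ≈⟨ *-assoc _ _ _ ⟨
        (- 1#) ^ suc n * det (B (suc n)) * last          ∎

  sum-identity : ∀ {n} (p : Fin n) (v : Vector Carrier n) → (identity *ᵥ v) p ≈ v p
  sum-identity zero    v = trans
    (+-cong (*-identityˡ _) (sum-zero _ λ q → zeroˡ (v (suc q)))) (+-identityʳ _)
  sum-identity (suc p) v = trans
    (+-cong (zeroˡ _) (sum-identity p (v ∘ suc))) (+-identityˡ _)

  eigenvector-kernel : ∀ {n} {M : Matrix Carrier n n} {ev v} → IsEigenvector M ev v →
                       ∀ p → sum (λ q → (M p q - ev * identity p q) * v q) ≈ 0#
  eigenvector-kernel {M = M} {ev} {v} isEigen p = begin
    sum (λ q → (M p q - ev * identity p q) * v q)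
      ≈⟨ sum-cong-≋ distribute ⟩
    sum (λ q → M p q * v q + - ev * (identity p q * v q))
      ≈⟨ ∑-distrib-+ (λ q → M p q * v q) (λ q → - ev * (identity p q * v q)) ⟩
    (M *ᵥ v) p + sum (λ q → - ev * (identity p q * v q))
      ≈⟨ +-cong (IsEigenvector.equation isEigen p)
                 (sym (*-distribˡ-sum (- ev) (λ q → identity p q * v q))) ⟩
    ev * v p + - ev * (identity *ᵥ v) p
      ≈⟨ +-congˡ (trans (*-congˡ (sum-identity p v)) (sym (-‿distribˡ-* _ _))) ⟩
    ev * v p - ev * v p
      ≈⟨ -‿inverseʳ _ ⟩
    0#  ∎
    where
    distribute : ∀ q → (M p q - ev * identity p q) * v q ≈
                       M p q * v q + - ev * (identity p q * v q)
    distribute q = trans (distribʳ _ _ _)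
      (+-congˡ (trans (*-congʳ (-‿distribˡ-* _ _)) (*-assoc _ _ _)))

  K-isUnitHessenbergToeplitz : ∀ k ev →
    IsUnitHessenbergToeplitz (λ n p q → K k n p q - ev * identity p q)
  K-isUnitHessenbergToeplitz k ev = record
    -- The `identity` term shifts definitionally, and off the diagonal it computes to `0#`; `1 × 1#`
    -- unfolds to `1# + 0#`.
    { toeplitz    = λ n p q → +-congʳ (reflexive (≡.cong (_× 1#) (entry-suc k (toℕ p) (toℕ q))))
    ; subdiagonal = λ n → trans (x-ev*0≈x _) (+-identityʳ 1#)
    ; hessenberg  = λ n p → x-ev*0≈x 0#
    }
    where
    x-ev*0≈x : ∀ x → x - ev * 0# ≈ x
    x-ev*0≈x x = trans (+-congˡ (trans (-‿cong (zeroʳ ev)) -0#≈0#)) (+-identityʳ x)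

  -- `x` is indexed by subscript, while the column vector lists subscripts in decreasing order,
  -- hence `reverse`. Position `opposite i` carries subscript `i`, and the last position carries
  -- subscript 0.
  eigenvector-coordinate : ∀ k n {ev} (x : Vector Carrier (suc n)) →
    IsEigenvector (K k (suc n)) ev (reverse x) →
    ∀ i → x i ≈ (- 1#) ^ toℕ i * charPoly (K k (toℕ i)) ev * x zero
  eigenvector-coordinate k n {ev} x isEigen i =
    ≡.subst₂ (λ a b → x a ≈ (- 1#) ^ toℕ a * charPoly (K k (toℕ a)) ev * x b)
      (opposite-involutive i) (opposite-involutive zero)
      (≡.subst (λ m → x j ≈ (- 1#) ^ m * charPoly (K k m) ev * x (opposite (fromℕ n)))
        (≡.sym (opposite-prop (opposite i)))
        (kernel-coordinate (K-isUnitHessenbergToeplitz k ev) n (reverse x)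
          (eigenvector-kernel isEigen ∘ suc) (opposite i)))
    where j = opposite (opposite i)

corollary2 : ∀ {c ℓ₁ ℓ₂} (F : HeytingField c ℓ₁ ℓ₂) →
    let open HeytingField F
        open OverField F
    in
    (k r : ℕ) → 3 ≤ k → (2≤r : 2 ≤ r) →
    (ev : Carrier) (x : Vector Carrier r) →
    IsEigenvector (K k r) ev (reverse x) →
    (i : ℕ) → 1 ≤ i → (i<r : i < r) →
    x (fromℕ< i<r) ≈ (- 1#) ^ i * charPoly (K k i) ev * x (fromℕ< (<⇒≤ 2≤r))
-- Matching on `2 ≤ r` exposes `r` as a successor, so the index of the last entry reduces to `zero`.
corollary2 F k (suc (suc n)) _ (s≤s (s≤s z≤n)) ev x isEigen i _ i<r =
  ≡.subst (λ m → x j ≈ (- 1#) ^ m * charPoly (K k m) ev * x zero) (toℕ-fromℕ< i<r)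
    (HessenbergToeplitz.eigenvector-coordinate F k (suc n) x isEigen j)
  where
  open HeytingField F using (_≈_; _*_; -_; 1#)
  open OverField F
  j = fromℕ< i<r
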